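{- Let $\Sigma$ be a finite set with at least two elements. Then the Büchi topology on $T_\Sigma^\omega$ is not metrizable (and hence not Polish).
   Context: $T_\Sigma^\omega$ is the set of maps $\{l,r\}^*\to\Sigma$ (infinite binary $\Sigma$-labelled trees). A Büchi tree automaton is $(\Sigma,Q,q_0,Q_f,\Delta)$ with $\Delta\subseteq Q\times\Sigma\times Q\times Q$; a run on $t$ is $\rho:\{l,r\}^*\to Q$ with $\rho(\text{root})=q_0$ and $(\rho(u),t(u),\rho(ul),\rho(ur))\in\Delta$; it is accepting if along every infinite branch some state of $Q_f$ occurs infinitely often; the automaton accepts the trees having an accepting run. The Büchi topology on $T_\Sigma^\omega$ is the topology generated by the tree languages accepted by Büchi tree automata. -}

module Defs where

open import Data.Fin using (Fin)
open import Data.Fin.Subset as Subset using (Subset)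
open import Data.List using (List; []; _++_; _∷ʳ_)
open import Data.List.Membership.Propositional using (_∈_)
open import Data.List.Relation.Unary.All as All using (All; [])
open import Data.List.Relation.Unary.All.Properties using (++⁺; ++⁻ˡ; ++⁻ʳ)
open import Data.Maybe using (Maybe; just)
open import Data.Nat as ℕ using (ℕ; zero; suc)
import Data.Nat.Properties as ℕ
open import Data.Product using (Σ; ∃; ∃-syntax; _×_; _,_; proj₁; proj₂)
open import Data.Rational as ℚ using (ℚ; 0ℚ; ½; ∣_∣)
import Data.Rational.Properties as ℚ
open import Function using (_⇔_)
open import Function.Metric.Structures using (IsGeneralMetric)
open import Level using (0ℓ)
open import Relation.Binary using (Setoid; IsPartialOrder; _Respects_)
open import Relation.Binary.PropositionalEquality
  using (_≡_; sym; trans; cong; subst; _→-setoid_; module ≡-Reasoning)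
open import Relation.Unary using (Pred; U; _∩_)

private
  half-pos : ∀ {ε} → 0ℚ ℚ.< ε → 0ℚ ℚ.< ½ ℚ.* ε
  half-pos {ε} 0<ε =
    subst (ℚ._< ½ ℚ.* ε) (ℚ.*-zeroʳ ½) (ℚ.*-monoʳ-<-pos ½ 0<ε)

  half+half : ∀ ε → ½ ℚ.* ε ℚ.+ ½ ℚ.* ε ≡ ε
  half+half ε = trans (sym (ℚ.*-distribʳ-+ ε ½ ½)) (ℚ.*-identityˡ ε)

  interchange : ∀ a b c d →
    (a ℚ.+ b) ℚ.- (c ℚ.+ d) ≡ (a ℚ.- c) ℚ.+ (b ℚ.- d)
  interchange a b c d = begin
    (a ℚ.+ b) ℚ.- (c ℚ.+ d)                ≡⟨ cong ((a ℚ.+ b) ℚ.+_) (ℚ.neg-distrib-+ c d) ⟩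
    (a ℚ.+ b) ℚ.+ (ℚ.- c ℚ.+ ℚ.- d)        ≡⟨ ℚ.+-assoc a b _ ⟩
    a ℚ.+ (b ℚ.+ (ℚ.- c ℚ.+ ℚ.- d))        ≡⟨ cong (a ℚ.+_) (sym (ℚ.+-assoc b (ℚ.- c) (ℚ.- d))) ⟩
    a ℚ.+ ((b ℚ.+ ℚ.- c) ℚ.+ ℚ.- d)        ≡⟨ cong (λ z → a ℚ.+ (z ℚ.+ ℚ.- d)) (ℚ.+-comm b _) ⟩
    a ℚ.+ ((ℚ.- c ℚ.+ b) ℚ.+ ℚ.- d)        ≡⟨ cong (a ℚ.+_) (ℚ.+-assoc (ℚ.- c) b (ℚ.- d)) ⟩
    a ℚ.+ (ℚ.- c ℚ.+ (b ℚ.- d))            ≡⟨ sym (ℚ.+-assoc a _ _) ⟩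
    (a ℚ.- c) ℚ.+ (b ℚ.- d)                ∎
    where open ≡-Reasoning

-- A real number is a Cauchy sequence of rationals; equality is _≈ᴿ_, not _≡_.
record ℝ : Set where
  field
    seq    : ℕ → ℚ
    cauchy : ∀ ε → 0ℚ ℚ.< ε →
             ∃[ N ] (∀ m n → N ℕ.≤ m → N ℕ.≤ n → ∣ seq m ℚ.- seq n ∣ ℚ.≤ ε)
open ℝ public

infix 4 _≤ᴿ_ _<ᴿ_ _≈ᴿ_
infixl 6 _+ᴿ_

_<ᴿ_ : ℝ → ℝ → Set
x <ᴿ y = ∃[ ε ] (0ℚ ℚ.< ε × ∃[ N ] (∀ n → N ℕ.≤ n → seq x n ℚ.+ ε ℚ.≤ seq y n))

_≤ᴿ_ : ℝ → ℝ → Set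
x ≤ᴿ y = ∀ ε → 0ℚ ℚ.< ε → ∃[ N ] (∀ n → N ℕ.≤ n → seq x n ℚ.≤ seq y n ℚ.+ ε)

_≈ᴿ_ : ℝ → ℝ → Set
x ≈ᴿ y = x ≤ᴿ y × y ≤ᴿ x

0ᴿ : ℝ
0ᴿ = record { seq = λ _ → 0ℚ ; cauchy = λ _ 0<ε → 0 , λ _ _ _ _ → ℚ.<⇒≤ 0<ε }

_+ᴿ_ : ℝ → ℝ → ℝ
seq (x +ᴿ y) n = seq x n ℚ.+ seq y n
cauchy (x +ᴿ y) ε 0<ε
  with M , hx ← cauchy x (½ ℚ.* ε) (half-pos 0<ε)
     | N , hy ← cauchy y (½ ℚ.* ε) (half-pos 0<ε)
  = M ℕ.⊔ N , λ m n p q → begin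
    ∣ (seq x m ℚ.+ seq y m) ℚ.- (seq x n ℚ.+ seq y n) ∣
      ≡⟨ cong ∣_∣ (interchange (seq x m) (seq y m) (seq x n) (seq y n)) ⟩
    ∣ (seq x m ℚ.- seq x n) ℚ.+ (seq y m ℚ.- seq y n) ∣
      ≤⟨ ℚ.∣p+q∣≤∣p∣+∣q∣ (seq x m ℚ.- seq x n) (seq y m ℚ.- seq y n) ⟩
    ∣ seq x m ℚ.- seq x n ∣ ℚ.+ ∣ seq y m ℚ.- seq y n ∣
      ≤⟨ ℚ.+-mono-≤ (hx m n (ℕ.m⊔n≤o⇒m≤o M N p) (ℕ.m⊔n≤o⇒m≤o M N q))
                    (hy m n (ℕ.m⊔n≤o⇒n≤o M N p) (ℕ.m⊔n≤o⇒n≤o M N q)) ⟩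
    ½ ℚ.* ε ℚ.+ ½ ℚ.* ε
      ≡⟨ half+half ε ⟩
    ε ∎
  where open ℚ.≤-Reasoning

≤ᴿ-refl : ∀ {x} → x ≤ᴿ x
≤ᴿ-refl {x} ε 0<ε = 0 , λ n _ → begin
  seq x n           ≡⟨ ℚ.+-identityʳ _ ⟨
  seq x n ℚ.+ 0ℚ    ≤⟨ ℚ.+-monoʳ-≤ (seq x n) (ℚ.<⇒≤ 0<ε) ⟩
  seq x n ℚ.+ ε     ∎
  where open ℚ.≤-Reasoning

≤ᴿ-trans : ∀ {x y z} → x ≤ᴿ y → y ≤ᴿ z → x ≤ᴿ z
≤ᴿ-trans {x} {y} {z} x≤y y≤z ε 0<ε
  with M , hx ← x≤y (½ ℚ.* ε) (half-pos 0<ε)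
     | N , hy ← y≤z (½ ℚ.* ε) (half-pos 0<ε)
  = M ℕ.⊔ N , λ n p → begin
    seq x n                                ≤⟨ hx n (ℕ.m⊔n≤o⇒m≤o M N p) ⟩
    seq y n ℚ.+ ½ ℚ.* ε                    ≤⟨ ℚ.+-monoˡ-≤ (½ ℚ.* ε) (hy n (ℕ.m⊔n≤o⇒n≤o M N p)) ⟩
    seq z n ℚ.+ ½ ℚ.* ε ℚ.+ ½ ℚ.* ε        ≡⟨ ℚ.+-assoc (seq z n) _ _ ⟩
    seq z n ℚ.+ (½ ℚ.* ε ℚ.+ ½ ℚ.* ε)      ≡⟨ cong (seq z n ℚ.+_) (half+half ε) ⟩
    seq z n ℚ.+ ε                          ∎
  where open ℚ.≤-Reasoning

-- IsGeneralMetric, used below, demands this of the codomain of the metric.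
≤ᴿ-isPartialOrder : IsPartialOrder _≈ᴿ_ _≤ᴿ_
≤ᴿ-isPartialOrder = record
  { isPreorder = record
    { isEquivalence = record
      { refl  = λ {x} → ≤ᴿ-refl {x} , ≤ᴿ-refl {x}
      ; sym   = λ (p , q) → q , p
      ; trans = λ {x} {y} {z} (p , p′) (q , q′) →
                  ≤ᴿ-trans {x} {y} {z} p q , ≤ᴿ-trans {z} {y} {x} q′ p′
      }
    ; reflexive = proj₁
    ; trans     = λ {x} {y} {z} → ≤ᴿ-trans {x} {y} {z}
    }
  ; antisym = _,_
  }

-- Since points are only compared up to _≈_, open sets have to be saturated.
record Topology (X : Setoid 0ℓ 0ℓ) : Set₁ where
  open Setoid X
  field
    Open    : Pred (Pred Carrier 0ℓ) 0ℓ
    respect : ∀ {V} → Open V → V Respects _≈_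
    U-open  : Open U
    ∩-open  : ∀ {V W} → Open V → Open W → Open (V ∩ W)
    ⋃-open  : ∀ {I : Set} (V : I → Pred Carrier 0ℓ) → (∀ i → Open (V i)) →
              Open (λ x → ∃[ i ] V i x)

-- The coarsest topology in which every S i is open: its open sets are the
-- unions of intersections of finitely many S i.
generated : (X : Setoid 0ℓ 0ℓ) {I : Set} (S : I → Pred (Setoid.Carrier X) 0ℓ) →
            (∀ i → S i Respects Setoid._≈_ X) → Topology X
generated X {I} S S-resp = record
  { Open    = Open
  ; respect = λ {V} o x≈y x∈V → let is , x∈B , B⊆V = o x∈V in
                B⊆V (All.map (λ {i} → S-resp i x≈y) x∈B)
  ; U-open  = λ _ → [] , [] , _
  ; ∩-open  = λ oV oW (x∈V , x∈W) →
                let is , x∈B , B⊆V = oV x∈V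
                    js , x∈C , C⊆W = oW x∈W
                in is ++ js , ++⁺ x∈B x∈C , λ y∈ → B⊆V (++⁻ˡ is y∈) , C⊆W (++⁻ʳ is y∈)
  ; ⋃-open  = λ V o (i , x∈V) →
                let is , x∈B , B⊆V = o i x∈V in is , x∈B , λ y∈ → i , B⊆V y∈
  }
  where
  open Setoid X
  Open : Pred (Pred Carrier 0ℓ) 0ℓ
  Open V = ∀ {x} → V x →
    ∃[ is ] (All (λ i → S i x) is × (∀ {y} → All (λ i → S i y) is → V y))

module _ {X : Setoid 0ℓ 0ℓ} where
  open Setoid X using (Carrier; _≈_)

  IsMetric : (Carrier → Carrier → ℝ) → Set
  IsMetric = IsGeneralMetric _≈_ _≈ᴿ_ _≤ᴿ_ 0ᴿ _+ᴿ_

  MetricOpen : (Carrier → Carrier → ℝ) → Pred (Pred Carrier 0ℓ) 0ℓ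
  MetricOpen d V = ∀ {x} → V x → ∃[ ε ] (0ᴿ <ᴿ ε × (∀ {y} → d x y <ᴿ ε → V y))

  Induces : (Carrier → Carrier → ℝ) → Topology X → Set₁
  Induces d τ = ∀ V → Topology.Open τ V ⇔ MetricOpen d V

  Metrizable : Topology X → Set₁
  Metrizable τ = ∃[ d ] (IsMetric d × Induces d τ)

  CauchySequence : (Carrier → Carrier → ℝ) → (ℕ → Carrier) → Set
  CauchySequence d s = ∀ ε → 0ᴿ <ᴿ ε →
    ∃[ N ] (∀ m n → N ℕ.≤ m → N ℕ.≤ n → d (s m) (s n) <ᴿ ε)

  ConvergesTo : (Carrier → Carrier → ℝ) → (ℕ → Carrier) → Carrier → Set
  ConvergesTo d s x = ∀ ε → 0ᴿ <ᴿ ε → ∃[ N ] (∀ n → N ℕ.≤ n → d (s n) x <ᴿ ε)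

  Complete : (Carrier → Carrier → ℝ) → Set
  Complete d = ∀ s → CauchySequence d s → ∃[ x ] ConvergesTo d s x

  CompletelyMetrizable : Topology X → Set₁
  CompletelyMetrizable τ = ∃[ d ] (IsMetric d × Complete d × Induces d τ)

  -- Maybe lets the countable dense set be finite or empty.
  Separable : Topology X → Set₁
  Separable τ = Σ (ℕ → Maybe Carrier) λ e →
    ∀ V → Topology.Open τ V → ∃ V → ∃[ n ] ∃[ y ] (e n ≡ just y × V y)

  Polish : Topology X → Set₁
  Polish τ = Separable τ × CompletelyMetrizable τ

data Direction : Set where
  l r : Direction

-- The root is [], and the children of u are u ∷ʳ l and u ∷ʳ r.
Node : Set
Node = List Direction

Tree : Set → Set
Tree A = Node → A

treeSetoid : Set → Setoid 0ℓ 0ℓ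
treeSetoid A = Node →-setoid A

Branch : Set
Branch = ℕ → Direction

prefix : Branch → ℕ → Node
prefix β zero    = []
prefix β (suc n) = prefix β n ∷ʳ β n

-- The finite set Δ is given by a list of its elements.
record BüchiTreeAutomaton (A : Set) : Set where
  field
    states : ℕ
  Q : Set
  Q = Fin states
  field
    q₀ : Q
    Qf : Subset states
    Δ  : List (Q × A × Q × Q)

module _ {A : Set} (𝒜 : BüchiTreeAutomaton A) where
  open BüchiTreeAutomaton 𝒜

  IsRun : Tree A → (Node → Q) → Set
  IsRun t ρ = ρ [] ≡ q₀ × (∀ u → (ρ u , t u , ρ (u ∷ʳ l) , ρ (u ∷ʳ r)) ∈ Δ)

  IsAccepting : (Node → Q) → Set
  IsAccepting ρ = ∀ (β : Branch) →
    ∃[ q ] (q Subset.∈ Qf × (∀ n → ∃[ m ] (n ℕ.≤ m × ρ (prefix β m) ≡ q)))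

  Language : Pred (Tree A) 0ℓ
  Language t = ∃[ ρ ] (IsRun t ρ × IsAccepting ρ)

  Language-respects-≈ : Language Respects Setoid._≈_ (treeSetoid A)
  Language-respects-≈ t≗t′ (ρ , (root , step) , acc) =
    ρ , (root , λ u → subst (λ a → (ρ u , a , ρ (u ∷ʳ l) , ρ (u ∷ʳ r)) ∈ Δ) (t≗t′ u) (step u)) , acc

büchiTopology : (A : Set) → Topology (treeSetoid A)
büchiTopology A = generated (treeSetoid A) (Language {A}) Language-respects-≈

{-# OPTIONS --safe #-}
module Submission where

-- In a metrizable space every closed set is the intersection of a sequence of open sets
-- G n.  Let V be the set of trees with a branch on which the label a occurs infinitely
-- often; it is accepted by a Büchi automaton, so its complement would be such an
-- intersection.  There are countably many automata, and by König's lemma a run is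
-- accepting iff the nodes carry ranks that decrease at each non-final state; hence
-- t ∈ ⋂ G n iff R t w for some w ∈ ℕ^ℕ, where R is closed.  But for every closed R there
-- is a tree t such that t ∈ V iff R t w for some w: label a node with a iff it codes a
-- finite sequence that, together with the part of t above that node, still extends to
-- an element of R.  This contradicts ⋂ G n being the complement of V.

open import Defs
open import Axiom.ExcludedMiddle using (ExcludedMiddle)
open import Data.Bool using (Bool; true; false)
open import Data.Fin using (Fin; zero; suc; toℕ; fromℕ<)
open import Data.Fin.Properties using (toℕ<n; fromℕ<-toℕ)
open import Data.Fin.Subset as Subset using (Subset; inside; outside)
open import Data.Fin.Subset.Properties using (_∈?_)
open import Data.Integer as ℤ using (+_)
import Data.Integer.Properties as ℤ
open import Data.List
  using (List; []; _∷_; _++_; _∷ʳ_; length; map; filter; foldl; allFin; cartesianProduct)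
open import Data.List.Properties
  using (++-assoc; ++-identityʳ; length-++; foldl-∷ʳ; ∷ʳ-injective)
open import Data.List.Membership.Propositional using (_∈_)
open import Data.List.Membership.Propositional.Properties
  using (∈-map⁺; ∈-allFin; ∈-filter⁺; ∈-filter⁻; ∈-cartesianProduct⁺)
open import Data.List.Relation.Unary.All as All using (All; []; _∷_)
open import Data.Maybe using (Maybe; just; nothing)
open import Data.Nat as ℕ
  using (ℕ; zero; suc; _+_; _⊔_; _≤_; _<_; z≤n; s≤s; _<?_; _≤′_; ≤′-refl; ≤′-step)
import Data.Nat.Properties as ℕ
open import Data.Nat.Coprimality using (1-coprimeTo)
open import Data.Nat.Induction using (<-rec; <-wellFounded)
open import Data.Product using (Σ; ∃; ∃-syntax; _×_; _,_; proj₁; proj₂)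
open import Data.Product.Function.Dependent.Propositional using (Σ-↪)
open import Data.Product.Function.NonDependent.Propositional using (_×-↪_)
open import Data.Rational as ℚ using (ℚ; mkℚ; 0ℚ; ½; ∣_∣; *≤*; *<*)
import Data.Rational.Properties as ℚ
open import Data.Sum using (inj₁; inj₂)
open import Data.Unit using (⊤; tt)
open import Data.Vec as Vec using (Vec; []; _∷_; here; there)
open import Data.Vec.Properties using (toList∘fromList)
open import Function using (_∘_; _↔_; _↪_; mk↪; Equivalence; Inverse; RightInverse)
open import Function.Construct.Composition using (_↪-∘_)
open import Function.Construct.Identity using (↪-id)
open import Function.Metric.Structures using (IsGeneralMetric)
open import Function.Properties.Inverse using (↔⇒↪)
open import Induction.WellFounded as WF using (WellFounded; module FixPoint)
open import Level using (0ℓ)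
open import Relation.Binary using (Setoid)
import Relation.Binary.Construct.On as On
open import Relation.Binary.PropositionalEquality
  using (_≡_; _≢_; refl; sym; trans; cong; subst)
open import Relation.Nullary using (¬_; Dec; yes; no; contradiction; decidable-stable)
open import Relation.Unary using (Pred)

-- Countability

-- `X ↪ Y` comes with a decoder `from` defined on all of `Y`; later this lets every `w` in ℕ^ℕ be
-- read as a code.
mkCode : ∀ {X Y : Set} (to : X → Y) (from : Y → X) → (∀ x → from (to x) ≡ x) → X ↪ Y
mkCode to from inv = mk↪ {to = to} {from = from} λ { {x} refl → inv x }

private
  nextPair : ℕ × ℕ → ℕ × ℕ
  nextPair (zero  , b) = suc b , zero
  nextPair (suc a , b) = a , suc b

  unpair : ℕ → ℕ × ℕ
  unpair zero    = zero , zero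
  unpair (suc n) = nextPair (unpair n)

  -- The pairs are listed by increasing sum s, and by increasing b for equal sums.
  unpair-reaches : ∀ s b {a} → a + b ≡ s → ∃[ n ] unpair n ≡ (a , b)
  unpair-reaches s (suc b) {a} eq
    with n , h ← unpair-reaches s b {suc a} (trans (sym (ℕ.+-suc a b)) eq) = suc n , cong nextPair h
  unpair-reaches s zero {zero} eq = zero , refl
  unpair-reaches (suc s) zero {suc a} eq
    with n , h ← unpair-reaches s s {zero} refl =
      suc n , trans (cong nextPair h) (cong (λ k → suc k , zero)
        (sym (trans (sym (ℕ.+-identityʳ a)) (ℕ.suc-injective eq))))

  ℕ×ℕ↪ℕ : (ℕ × ℕ) ↪ ℕ
  ℕ×ℕ↪ℕ = mkCode (λ (a , b) → proj₁ (unpair-reaches (a + b) b refl)) unpair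
    λ (a , b) → proj₂ (unpair-reaches (a + b) b refl)

×↪ℕ : ∀ {X Y : Set} → X ↪ ℕ → Y ↪ ℕ → (X × Y) ↪ ℕ
×↪ℕ f g = ℕ×ℕ↪ℕ ↪-∘ (f ×-↪ g)

Σ↪ℕ : ∀ {X : Set} {Y : X → Set} → X ↪ ℕ → (∀ x → Y x ↪ ℕ) → Σ X Y ↪ ℕ
Σ↪ℕ f g = ℕ×ℕ↪ℕ ↪-∘ Σ-↪ f (λ {k} → g (RightInverse.from f k))

Vec↪ℕ : ∀ {X : Set} → X ↪ ℕ → ∀ n → Vec X n ↪ ℕ
Vec↪ℕ f zero    = mkCode (λ _ → 0) (λ _ → []) λ { [] → refl }
Vec↪ℕ f (suc n) =
  ×↪ℕ f (Vec↪ℕ f n) ↪-∘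
  mkCode (λ { (x ∷ xs) → x , xs }) (λ (x , xs) → x ∷ xs) (λ { (x ∷ xs) → refl })

List↪ℕ : ∀ {X : Set} → X ↪ ℕ → List X ↪ ℕ
List↪ℕ f =
  Σ↪ℕ (↪-id ℕ) (Vec↪ℕ f) ↪-∘
  mkCode (λ xs → length xs , Vec.fromList xs) (Vec.toList ∘ proj₂) toList∘fromList

All↪ℕ : ∀ {X : Set} {P : X → Set} → (∀ x → P x ↪ ℕ) → ∀ xs → All P xs ↪ ℕ
All↪ℕ f []       = mkCode (λ _ → 0) (λ _ → []) λ { [] → refl }
All↪ℕ f (x ∷ xs) =
  ×↪ℕ (f x) (All↪ℕ f xs) ↪-∘
  mkCode (λ { (p ∷ ps) → p , ps }) (λ (p , ps) → p ∷ ps) (λ { (p ∷ ps) → refl })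

-- Since the decoder must be total, `i₀` is what the numbers from `n` on decode to.
Fin↪ℕ : ∀ {n} → Fin n → Fin n ↪ ℕ
Fin↪ℕ {n} i₀ = mkCode toℕ from from-toℕ
  where
  from : ℕ → Fin n
  from k with k <? n
  ... | yes k<n = fromℕ< k<n
  ... | no _    = i₀
  from-toℕ : ∀ i → from (toℕ i) ≡ i
  from-toℕ i with toℕ i <? n
  ... | yes k<n = fromℕ<-toℕ i k<n
  ... | no k≮n  = contradiction (toℕ<n i) k≮n

Maybe↪ℕ : ∀ {X : Set} → X ↪ ℕ → Maybe X ↪ ℕ
Maybe↪ℕ f = mkCode (λ { nothing → 0 ; (just x) → suc (to x) })
  (λ { zero → nothing ; (suc k) → just (from k) })
  λ { nothing → refl ; (just x) → cong just (strictlyInverseʳ x) }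
  where open RightInverse f

Bool↪ℕ : Bool ↪ ℕ
Bool↪ℕ = mkCode (λ { false → 0 ; true → 1 }) (λ { zero → false ; (suc _) → true })
  λ { false → refl ; true → refl }

Node↪ℕ : Node ↪ ℕ
Node↪ℕ = List↪ℕ (mkCode (λ { l → 0 ; r → 1 }) (λ { zero → l ; (suc _) → r })
  λ { l → refl ; r → refl })

BüchiTreeAutomaton↪ℕ : ∀ {A : Set} → A ↪ ℕ → BüchiTreeAutomaton A ↪ ℕ
BüchiTreeAutomaton↪ℕ {A} f = Σ↪ℕ (↪-id ℕ) Raw↪ℕ ↪-∘ mkCode to from from-to
  where
  -- The initial state rules out `states = 0`, so `k` is the number of states minus one and `zero`
  -- is always a state to decode to.
  Raw : ℕ → Set
  Raw k = Fin (suc k) × Subset (suc k) × List (Fin (suc k) × A × Fin (suc k) × Fin (suc k))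
  Raw↪ℕ : ∀ k → Raw k ↪ ℕ
  Raw↪ℕ k = ×↪ℕ Q↪ℕ (×↪ℕ (Vec↪ℕ Bool↪ℕ (suc k)) (List↪ℕ (×↪ℕ Q↪ℕ (×↪ℕ f (×↪ℕ Q↪ℕ Q↪ℕ)))))
    where
    Q↪ℕ : Fin (suc k) ↪ ℕ
    Q↪ℕ = Fin↪ℕ zero
  to : BüchiTreeAutomaton A → Σ ℕ Raw
  to record { states = suc k ; q₀ = q₀ ; Qf = Qf ; Δ = Δ } = k , q₀ , Qf , Δ
  from : Σ ℕ Raw → BüchiTreeAutomaton A
  from (k , q₀ , Qf , Δ) = record { states = suc k ; q₀ = q₀ ; Qf = Qf ; Δ = Δ }
  from-to : ∀ 𝒜 → from (to 𝒜) ≡ 𝒜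
  from-to record { states = suc k } = refl

-- Branches, König's lemma and ranked runs

InfinitelyOften : Pred ℕ 0ℓ → Set
InfinitelyOften P = ∀ n → ∃[ m ] (n ≤ m × P m)

length-∷ʳ : (u : Node) (d : Direction) → length (u ∷ʳ d) ≡ suc (length u)
length-∷ʳ u d = trans (length-++ u) (ℕ.+-comm (length u) 1)

length-prefix : ∀ β n → length (prefix β n) ≡ n
length-prefix β zero    = refl
length-prefix β (suc n) = trans (length-∷ʳ (prefix β n) (β n)) (cong suc (length-prefix β n))

-- `prefix` grows at the far end, whereas `prepend` recurses at the root; this equation reconciles
-- the two.
prefix-suc : ∀ β n → prefix β (suc n) ≡ β 0 ∷ prefix (β ∘ suc) n
prefix-suc β zero    = refl
prefix-suc β (suc n) = cong (_∷ʳ β (suc n)) (prefix-suc β n)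

prepend : Node → Branch → Branch
prepend []      β n       = β n
prepend (d ∷ u) β zero    = d
prepend (d ∷ u) β (suc n) = prepend u β n

prefix-prepend : ∀ u β n → prefix (prepend u β) (length u + n) ≡ u ++ prefix β n
prefix-prepend []      β zero    = refl
prefix-prepend []      β (suc n) = cong (_∷ʳ β n) (prefix-prepend [] β n)
prefix-prepend (d ∷ u) β n       =
  trans (prefix-suc (prepend (d ∷ u) β) (length u + n)) (cong (d ∷_) (prefix-prepend u β n))

module _ (P : Pred Node 0ℓ) (step : ∀ u → P u → ∃[ d ] P (u ∷ʳ d)) where

  private
    walk : ∃ P → ℕ → ∃ P
    walk p zero    = p
    walk p (suc n) = let u , pu = walk p n ; d , pud = step u pu in u ∷ʳ d , pud

  -- The directions are relative to the starting node, so prefixes of this branch are to be appended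
  -- to `proj₁ p`.
  path : ∃ P → Branch
  path p n = let u , pu = walk p n in proj₁ (step u pu)

  path-satisfies : ∀ p n → P (proj₁ p ++ prefix (path p) n)
  path-satisfies p n = subst P (walk≡ n) (proj₂ (walk p n))
    where
    walk≡ : ∀ n → proj₁ (walk p n) ≡ proj₁ p ++ prefix (path p) n
    walk≡ zero    = sym (++-identityʳ (proj₁ p))
    walk≡ (suc n) = trans (cong (_∷ʳ path p n) (walk≡ n)) (++-assoc (proj₁ p) _ _)

module _ (em : ExcludedMiddle 0ℓ) where

  ¬¬-elim : ∀ {P : Set} → ¬ ¬ P → P
  ¬¬-elim = decidable-stable em

  ¬∀⇒∃¬ : ∀ {X : Set} {P : Pred X 0ℓ} → ¬ (∀ x → P x) → ∃[ x ] ¬ P x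
  ¬∀⇒∃¬ ¬∀ = ¬¬-elim λ ¬∃ → ¬∀ λ x → ¬¬-elim λ ¬p → ¬∃ (x , ¬p)

  least : (P : Pred ℕ 0ℓ) → ∃ P → ∃[ n ] (P n × ∀ m → P m → n ≤ m)
  least P (n , p) = <-rec (λ n → P n → ∃[ n ] (P n × ∀ m → P m → n ≤ m)) go n p
    where
    go : ∀ n → (∀ {m} → m < n → P m → ∃[ n ] (P n × ∀ m → P m → n ≤ m)) →
         P n → ∃[ n ] (P n × ∀ m → P m → n ≤ m)
    go n rec p with em {∃[ m ] (m < n × P m)}
    ... | yes (m , m<n , q) = rec m<n q
    ... | no none           = n , p , λ m q → ℕ.≮⇒≥ λ m<n → none (m , m<n , q)

  -- Induction on the number of colours: if colour `zero` does not occur from some `N` on, the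
  -- remaining colours must recur.
  infinite-pigeonhole : ∀ k (P : Fin k → Pred ℕ 0ℓ) →
    InfinitelyOften (λ m → ∃[ i ] P i m) → ∃[ i ] InfinitelyOften (P i)
  infinite-pigeonhole zero    P io with () ← proj₁ (proj₂ (proj₂ (io 0)))
  infinite-pigeonhole (suc k) P io with em {InfinitelyOften (P zero)}
  ... | yes io₀ = zero , io₀
  ... | no ¬io₀ with N , none ← ¬∀⇒∃¬ ¬io₀ =
    let i , ioᵢ = infinite-pigeonhole k (P ∘ suc) later in suc i , ioᵢ
    where
    later : InfinitelyOften (λ m → ∃[ i ] P (suc i) m)
    later n with io (n ⊔ N)
    ... | m , le , zero  , p = contradiction (m , ℕ.m⊔n≤o⇒n≤o n N le , p) none
    ... | m , le , suc i , p = m , ℕ.m⊔n≤o⇒m≤o n N le , i , p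

  module _ (F : Pred Node 0ℓ) where

    -- A bar of bounded depth: every path from `u` meets `F` within `n` steps.
    data Bar : ℕ → Node → Set where
      here  : ∀ {n u} → F u → Bar n u
      later : ∀ {n u} → Bar n (u ∷ʳ l) → Bar n (u ∷ʳ r) → Bar (suc n) u

    Bar-mono : ∀ {m n u} → m ≤ n → Bar m u → Bar n u
    Bar-mono m≤n       (here f)    = here f
    Bar-mono (s≤s m≤n) (later a b) = later (Bar-mono m≤n a) (Bar-mono m≤n b)

    Bar-children : ∀ {n u} → ¬ F u → Bar n u →
      ∃[ m ] (n ≡ suc m × Bar m (u ∷ʳ l) × Bar m (u ∷ʳ r))
    Bar-children ¬f (here f)    = contradiction f ¬f
    Bar-children ¬f (later a b) = _ , refl , a , b

    -- König's lemma by contraposition: if both children were barred, so would be the node, one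
    -- level deeper. Hence an unbarred node starts a path of unbarred nodes, which never meets `F`.
    barred : (∀ β n → ∃[ m ] (n ≤ m × F (prefix β m))) → ∀ u → ∃[ n ] Bar n u
    barred io u = ¬¬-elim unbarred-absurd
      where
      Unbarred : Pred Node 0ℓ
      Unbarred v = ¬ (∃[ n ] Bar n v)
      unbarred-child : ∀ v → Unbarred v → ∃[ d ] Unbarred (v ∷ʳ d)
      unbarred-child v ¬b = ¬¬-elim λ ¬child →
        let m , p = ¬¬-elim {∃[ m ] Bar m (v ∷ʳ l)} λ ¬p → ¬child (l , ¬p)
            n , q = ¬¬-elim {∃[ n ] Bar n (v ∷ʳ r)} λ ¬q → ¬child (r , ¬q)
        in ¬b (suc (m ⊔ n) , later (Bar-mono (ℕ.m≤m⊔n m n) p) (Bar-mono (ℕ.m≤n⊔m m n) q))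
      unbarred-absurd : ¬ Unbarred u
      unbarred-absurd ¬b =
        let β             = path Unbarred unbarred-child (u , ¬b)
            -- Asking for depth at least `length u` makes the node found lie on the unbarred path
            -- below `u`, or at `u` itself.
            m , ∣u∣≤m , f = io (prepend u β) (length u)
            n , ∣u∣+n≡m   = ℕ.m≤n⇒∃[o]m+o≡n ∣u∣≤m
            node≡         = trans (cong (prefix (prepend u β)) (sym ∣u∣+n≡m)) (prefix-prepend u β n)
        in path-satisfies Unbarred unbarred-child (u , ¬b) n (0 , here (subst F node≡ f))

    module _ (io : ∀ β n → ∃[ m ] (n ≤ m × F (prefix β m))) where

      rank : Node → ℕ
      rank u = proj₁ (least (λ n → Bar n u) (barred io u))

      private
        rank-bar : ∀ u → Bar (rank u) u
        rank-bar u = proj₁ (proj₂ (least (λ n → Bar n u) (barred io u)))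

        rank-least : ∀ u n → Bar n u → rank u ≤ n
        rank-least u = proj₂ (proj₂ (least (λ n → Bar n u) (barred io u)))

      -- Outside `F`, a bar of least depth must split, which gives both children bars that are one
      -- level shallower.
      rank-decreases : ∀ u → ¬ F u → rank (u ∷ʳ l) < rank u × rank (u ∷ʳ r) < rank u
      rank-decreases u ¬f =
        let _ , eq , a , b = Bar-children ¬f (rank-bar u)
        in subst (rank (u ∷ʳ l) <_) (sym eq) (s≤s (rank-least _ _ a)) ,
           subst (rank (u ∷ʳ r) <_) (sym eq) (s≤s (rank-least _ _ b))

module _ {A : Set} (𝒜 : BüchiTreeAutomaton A) where
  open BüchiTreeAutomaton 𝒜

  RankedState : Set
  RankedState = Q × ℕ

  -- Decreasing ranks turn acceptance into a condition on a node and its two children only; this is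
  -- what makes `Witnesses` closed.
  RankedStep : A → RankedState → RankedState → RankedState → Set
  RankedStep a (q , h) (qₗ , hₗ) (qᵣ , hᵣ) =
    (q , a , qₗ , qᵣ) ∈ Δ × (q Subset.∉ Qf → hₗ < h × hᵣ < h)

  IsRankedRun : Tree A → (Node → RankedState) → Set
  IsRankedRun t s =
    proj₁ (s []) ≡ q₀ × (∀ u → RankedStep (t u) (s u) (s (u ∷ʳ l)) (s (u ∷ʳ r)))

  module _ (em : ExcludedMiddle 0ℓ) where

    Language⇒ranked : ∀ {t} → Language 𝒜 t → ∃ (IsRankedRun t)
    Language⇒ranked {t} (ρ , (root , step) , acc) =
      (λ u → ρ u , rank em F io u) , root , λ u → step u , rank-decreases em F io u
      where
      F : Pred Node 0ℓ
      F u = ρ u Subset.∈ Qf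
      io : ∀ β n → ∃[ m ] (n ≤ m × F (prefix β m))
      io β n with q , q∈ , often ← acc β with m , n≤m , eq ← often n =
        m , n≤m , subst (Subset._∈ Qf) (sym eq) q∈

    -- Ranks cannot decrease forever, so final states recur on every branch; the pigeonhole
    -- principle then provides the single recurring state that `IsAccepting` asks for.
    ranked⇒Language : ∀ {t} → ∃ (IsRankedRun t) → Language 𝒜 t
    ranked⇒Language {t} (s , root , step) = ρ , (root , λ u → proj₁ (step u)) , accepting
      where
      ρ : Node → Q
      ρ = proj₁ ∘ s
      h : Node → ℕ
      h = proj₂ ∘ s
      h-decreases : ∀ u d → ρ u Subset.∉ Qf → h (u ∷ʳ d) < h u
      h-decreases u l q∉ = proj₁ (proj₂ (step u) q∉)
      h-decreases u r q∉ = proj₂ (proj₂ (step u) q∉)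
      visits : ∀ β k n → h (prefix β n) < k → ∃[ m ] (n ≤ m × ρ (prefix β m) Subset.∈ Qf)
      visits β (suc k) n (s≤s h≤k) with ρ (prefix β n) ∈? Qf
      ... | yes q∈ = n , ℕ.≤-refl , q∈
      ... | no q∉
        with m , n<m , q∈ ← visits β k (suc n) (ℕ.<-≤-trans (h-decreases (prefix β n) (β n) q∉) h≤k)
        = m , ℕ.<⇒≤ n<m , q∈
      accepting : IsAccepting 𝒜 ρ
      accepting β
        with q , often ← infinite-pigeonhole em states
               (λ q m → ρ (prefix β m) ≡ q × q Subset.∈ Qf)
               (λ n → let m , n≤m , q∈ = visits β (suc (h (prefix β n))) n ℕ.≤-refl
                      in m , n≤m , ρ (prefix β m) , refl , q∈)
        = q , proj₂ (proj₂ (proj₂ (often 0))) ,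
          λ n → let m , n≤m , eq , _ = often n in m , n≤m , eq

-- The diagonal tree

-- A branch with infinitely many l's is read as the sequence w ∈ ℕ^ℕ for which
-- it is r^(w 0) l r^(w 1) l …; a parse state consists of the number of complete
-- blocks, the length of the current block, and the lengths of the complete blocks
-- (the last component is junk from the first component on).
ParseState : Set
ParseState = ℕ × ℕ × (ℕ → ℕ)

extendAt : ℕ → ℕ → (ℕ → ℕ) → ℕ → ℕ
extendAt k c w j with j <? k
... | yes _ = w j
... | no _  = c

extendAt-< : ∀ {k c w j} → j < k → extendAt k c w j ≡ w j
extendAt-< {k} {j = j} j<k with j <? k
... | yes _   = refl
... | no j≮k = contradiction j<k j≮k

extendAt-≡ : ∀ k {c w} → extendAt k c w k ≡ c
extendAt-≡ k with k <? k
... | yes k<k = contradiction k<k (ℕ.<-irrefl refl)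
... | no _    = refl

parseStep : ParseState → Direction → ParseState
parseStep (k , c , w) r = k , suc c , w
parseStep (k , c , w) l = suc k , 0 , extendAt k c w

parse : Node → ParseState
parse = foldl parseStep (0 , 0 , λ _ → 0)

blocks current : Node → ℕ
blocks  = proj₁ ∘ parse
current = proj₁ ∘ proj₂ ∘ parse

block : Node → ℕ → ℕ
block = proj₂ ∘ proj₂ ∘ parse

parse-∷ʳ : ∀ u d → parse (u ∷ʳ d) ≡ parseStep (parse u) d
parse-∷ʳ u d = foldl-∷ʳ parseStep _ d u

blocks-mono : ∀ u d → blocks u ≤ blocks (u ∷ʳ d)
blocks-mono u d rewrite parse-∷ʳ u d with d
... | l = ℕ.n≤1+n (blocks u)
... | r = ℕ.≤-refl

block-stable : ∀ u d {j} → j < blocks u → block (u ∷ʳ d) j ≡ block u j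
block-stable u d j< rewrite parse-∷ʳ u d with d
... | l = extendAt-< j<
... | r = refl

-- Only `l` leaves the current block empty, and it has just completed a block.
blocks-current≡0 : ∀ u d → current (u ∷ʳ d) ≡ 0 → blocks (u ∷ʳ d) ≡ suc (blocks u)
blocks-current≡0 u d eq rewrite parse-∷ʳ u d with d | eq
... | l | _  = refl
... | r | ()

module _ (β : Branch) where

  blocks-mono-prefix : ∀ {m n} → m ≤′ n → blocks (prefix β m) ≤ blocks (prefix β n)
  blocks-mono-prefix ≤′-refl           = ℕ.≤-refl
  blocks-mono-prefix (≤′-step {n} m≤n) =
    ℕ.≤-trans (blocks-mono-prefix m≤n) (blocks-mono (prefix β n) (β n))

  block-stable-prefix : ∀ {m n j} → m ≤′ n → j < blocks (prefix β m) →
    block (prefix β n) j ≡ block (prefix β m) j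
  block-stable-prefix ≤′-refl           j< = refl
  block-stable-prefix (≤′-step {n} m≤n) j< = trans
    (block-stable (prefix β n) (β n) (ℕ.<-≤-trans j< (blocks-mono-prefix m≤n)))
    (block-stable-prefix m≤n j<)

  module _ (io : InfinitelyOften (λ n → current (prefix β n) ≡ 0)) where

    blocks-grow : ∀ n → ∃[ m ] blocks (prefix β n) < blocks (prefix β m)
    blocks-grow n with suc m , s≤s n≤m , eq ← io (suc n) = suc m ,
      ℕ.≤-trans (s≤s (blocks-mono-prefix (ℕ.≤⇒≤′ n≤m)))
        (ℕ.≤-reflexive (sym (blocks-current≡0 (prefix β m) (β m) eq)))

    blocks-unbounded : ∀ j → ∃[ n ] j < blocks (prefix β n)
    blocks-unbounded zero with n , lt ← blocks-grow 0 = n , lt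
    blocks-unbounded (suc j)
      with m , lt ← blocks-unbounded j
      with n , lt′ ← blocks-grow m = n , ℕ.≤-<-trans lt lt′

    decode : ℕ → ℕ
    decode j = block (prefix β (proj₁ (blocks-unbounded j))) j

    -- Complete blocks never change, so any two prefixes with more than `j` blocks agree on block
    -- `j`.
    decode-block : ∀ n {j} → j < blocks (prefix β n) → decode j ≡ block (prefix β n) j
    decode-block n {j} j< with blocks-unbounded j
    ... | m , j<′ with ℕ.≤-total m n
    ... | inj₁ m≤n = sym (block-stable-prefix (ℕ.≤⇒≤′ m≤n) j<′)
    ... | inj₂ n≤m = block-stable-prefix (ℕ.≤⇒≤′ n≤m) j<

module _ (w : ℕ → ℕ) where

  -- These are the prefixes of the code of `w`: the next letter is `r` until the current block has
  -- the right length, then `l`.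
  Parses : Pred Node 0ℓ
  Parses u = current u ≤ w (blocks u) × (∀ j → j < blocks u → w j ≡ block u j)

  parses-child : ∀ u → Parses u → ∃[ d ] Parses (u ∷ʳ d)
  parses-child u (cur≤ , agree) with current u <? w (blocks u)
  ... | yes cur< = r , subst (λ (k , c , v) → c ≤ w k × (∀ j → j < k → w j ≡ v j))
                         (sym (parse-∷ʳ u r)) (cur< , agree)
  ... | no cur≮  = l , subst (λ (k , c , v) → c ≤ w k × (∀ j → j < k → w j ≡ v j))
                         (sym (parse-∷ʳ u l)) (z≤n , agree′)
    where
    agree′ : ∀ j → j < suc (blocks u) → w j ≡ extendAt (blocks u) (current u) (block u) j
    agree′ j j< with ℕ.m<1+n⇒m<n∨m≡n j<
    ... | inj₁ j<k  = trans (agree j j<k) (sym (extendAt-< j<k))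
    ... | inj₂ refl = trans (ℕ.≤-antisym (ℕ.≮⇒≥ cur≮) cur≤) (sym (extendAt-≡ (blocks u)))

  parses-root : Parses []
  parses-root = z≤n , λ _ ()

  encode : Branch
  encode = path Parses parses-child ([] , parses-root)

  encode-parses : ∀ n → Parses (prefix encode n)
  encode-parses = path-satisfies Parses parses-child ([] , parses-root)

  encode-current≡0 : InfinitelyOften (λ n → current (prefix encode n) ≡ 0)
  encode-current≡0 n = go (suc (w (blocks (prefix encode n)))) n (ℕ.m≤n+m _ _)
    where
    -- `k` exceeds the number of letters `r` still missing before the next `l`.
    go : ∀ k n → w (blocks (prefix encode n)) < current (prefix encode n) + k →
         ∃[ m ] (n ≤ m × current (prefix encode m) ≡ 0)
    go zero n lt = contradiction (proj₁ (encode-parses n))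
      (ℕ.<⇒≱ (subst (w (blocks (prefix encode n)) <_) (ℕ.+-identityʳ _) lt))
    go (suc k) n lt with encode n in eq
    ... | l = suc n , ℕ.n≤1+n n ,
      cong (proj₁ ∘ proj₂) (trans (cong (λ d → parse (prefix encode n ∷ʳ d)) eq)
                                  (parse-∷ʳ (prefix encode n) l))
    ... | r =
      let fuel = subst (λ (j , c , _) → w j < c + k)
            (sym (trans (cong (λ d → parse (prefix encode n ∷ʳ d)) eq)
                        (parse-∷ʳ (prefix encode n) r)))
            (subst (w (blocks (prefix encode n)) <_) (ℕ.+-suc _ k) lt)
          m , n<m , z = go k (suc n) fuel
      in m , ℕ.<⇒≤ n<m , z

HasBranch : {A : Set} → A → Tree A → Set
HasBranch a t = ∃[ β ] InfinitelyOften (λ n → t (prefix β n) ≡ a)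

-- Closedness in the product topology of A^Node × ℕ^ℕ with discrete factors, not in the Büchi
-- topology.
IsClosed : {A : Set} → (Tree A → (ℕ → ℕ) → Set) → Set
IsClosed R = ∀ t w →
  (∀ k → ∃[ t′ ] ∃[ w′ ] ((∀ u → length u < k → t′ u ≡ t u) ×
                          (∀ j → j < k → w′ j ≡ w j) × R t′ w′)) →
  R t w

module _ (em : ExcludedMiddle 0ℓ) {A : Set} {a b : A} (a≢b : a ≢ b)
         (R : Tree A → (ℕ → ℕ) → Set) where

  private
    _≺_ : Node → Node → Set
    u ≺ v = length u < length v

    ≺-wellFounded : WellFounded _≺_
    ≺-wellFounded = On.wellFounded length <-wellFounded

    -- `current u ≡ 0` makes `u` the code of a finite sequence. Only labels at smaller depth are
    -- consulted, so `diagonal` can be defined by recursion on depth.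
    Extendable : ∀ u → (∀ v → v ≺ u → A) → Set
    Extendable u t↾u = current u ≡ 0 ×
      ∃[ t′ ] ∃[ w′ ] ((∀ v (v≺u : v ≺ u) → t′ v ≡ t↾u v v≺u) ×
                       (∀ j → j < blocks u → w′ j ≡ block u j) × R t′ w′)

    label : ∀ u → (∀ v → v ≺ u → A) → A
    label u t↾u with em {Extendable u t↾u}
    ... | yes _ = a
    ... | no _  = b

    label≡a : ∀ u t↾u → Extendable u t↾u → label u t↾u ≡ a
    label≡a u t↾u e with em {Extendable u t↾u}
    ... | yes _ = refl
    ... | no ¬e = contradiction e ¬e

    label≡a⁻¹ : ∀ u t↾u → label u t↾u ≡ a → Extendable u t↾u
    label≡a⁻¹ u t↾u eq with em {Extendable u t↾u}
    ... | yes e = e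
    ... | no _  = contradiction (sym eq) a≢b

    -- Unfolding the well-founded recursion asks that a label depend only on the values of the
    -- labels above it.
    label-ext : ∀ u {t↾u s↾u : ∀ v → v ≺ u → A} →
      (∀ v (v≺u : v ≺ u) → t↾u v v≺u ≡ s↾u v v≺u) → label u t↾u ≡ label u s↾u
    label-ext u {t↾u} {s↾u} t≡s with em {Extendable u t↾u}
    ... | yes (z , t′ , w′ , agree , rest) = sym (label≡a u s↾u
            (z , t′ , w′ , (λ v v≺u → trans (agree v v≺u) (t≡s v v≺u)) , rest))
    ... | no ¬e with em {Extendable u s↾u}
    ... | yes (z , t′ , w′ , agree , rest) = contradiction
            (z , t′ , w′ , (λ v v≺u → trans (agree v v≺u) (sym (t≡s v v≺u))) , rest) ¬e
    ... | no _  = refl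

  diagonal : Tree A
  diagonal = WF.All.wfRec ≺-wellFounded 0ℓ (λ _ → A) λ u t↾u → label u λ v → t↾u {v}

  private
    diagonal-unfold : ∀ u → diagonal u ≡ label u (λ v _ → diagonal v)
    diagonal-unfold u = FixPoint.unfold-wfRec ≺-wellFounded (λ _ → A)
      (λ u t↾u → label u λ v → t↾u {v}) (λ u t≡s → label-ext u λ v → t≡s {v}) {u}

    extendable : ∀ u → diagonal u ≡ a → Extendable u (λ v _ → diagonal v)
    extendable u eq = label≡a⁻¹ u _ (trans (sym (diagonal-unfold u)) eq)

  -- At each block boundary on the code of `w`, the diagonal tree and `w` are themselves the
  -- required extension.
  diagonal-HasBranch : ∃ (R diagonal) → HasBranch a diagonal
  diagonal-HasBranch (w , Rw) = encode w , λ n →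
    let m , n≤m , z = encode-current≡0 w n ; u = prefix (encode w) m in
    m , n≤m , trans (diagonal-unfold u)
      (label≡a u _ (z , diagonal , w , (λ _ _ → refl) , proj₂ (encode-parses w m) , Rw))

  -- Each `a` on the branch provides a pair in `R` that agrees with the diagonal tree above that
  -- node and with the sequence decoded so far; closedness passes to the limit.
  diagonal-HasBranch⁻¹ : IsClosed R → HasBranch a diagonal → ∃ (R diagonal)
  diagonal-HasBranch⁻¹ closed (β , io) = decode β io₀ , closed diagonal (decode β io₀) approximate
    where
    io₀ : InfinitelyOften (λ n → current (prefix β n) ≡ 0)
    io₀ n = let m , n≤m , eq = io n in m , n≤m , proj₁ (extendable (prefix β m) eq)
    approximate : ∀ k → ∃[ t′ ] ∃[ w′ ] ((∀ u → length u < k → t′ u ≡ diagonal u) ×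
                    (∀ j → j < k → w′ j ≡ decode β io₀ j) × R t′ w′)
    approximate k =
      -- From `n` on there are more than `k` complete blocks; a node of depth at least `k` secures
      -- agreement of the trees at depths below `k`.
      let n , k<       = blocks-unbounded β io₀ k
          m , n⊔k≤m , eq = io (n ⊔ k)
          _ , t′ , w′ , t′≡ , w′≡ , Rt′w′ = extendable (prefix β m) eq
          k≤m   = subst (k ≤_) (sym (length-prefix β m)) (ℕ.m⊔n≤o⇒n≤o n k n⊔k≤m)
          k≤blocks = ℕ.≤-trans (ℕ.<⇒≤ k<)
                       (blocks-mono-prefix β (ℕ.≤⇒≤′ (ℕ.m⊔n≤o⇒m≤o n k n⊔k≤m)))
      in t′ , w′ , (λ u u<k → t′≡ u (ℕ.<-≤-trans u<k k≤m)) ,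
         (λ j j<k → let j< = ℕ.<-≤-trans j<k k≤blocks in
           trans (w′≡ j j<) (sym (decode-block β io₀ m j<))) , Rt′w′

-- Countable intersections of open sets

module _ {A : Set} where

  -- Basic open sets are intersections of finitely many languages, hence one ranked state for each
  -- automaton of a list.
  JointState : List (BüchiTreeAutomaton A) → Set
  JointState = All RankedState

  JointInitial : ∀ {𝒜s} → JointState 𝒜s → Set
  JointInitial []                       = ⊤
  JointInitial (_∷_ {x = 𝒜} (q , _) ss) = q ≡ BüchiTreeAutomaton.q₀ 𝒜 × JointInitial ss

  JointStep : ∀ {𝒜s} → A → JointState 𝒜s → JointState 𝒜s → JointState 𝒜s → Set
  JointStep a []                 _          _          = ⊤
  JointStep a (_∷_ {x = 𝒜} s ss) (sₗ ∷ ssₗ) (sᵣ ∷ ssᵣ) =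
    RankedStep 𝒜 a s sₗ sᵣ × JointStep a ss ssₗ ssᵣ

  IsJointRun : ∀ {𝒜s} → Tree A → (Node → JointState 𝒜s) → Set
  IsJointRun t s = JointInitial (s []) × (∀ u → JointStep (t u) (s u) (s (u ∷ʳ l)) (s (u ∷ʳ r)))

  JointInitial-head : ∀ {𝒜 𝒜s} (s : JointState (𝒜 ∷ 𝒜s)) → JointInitial s →
    proj₁ (All.head s) ≡ BüchiTreeAutomaton.q₀ 𝒜 × JointInitial (All.tail s)
  JointInitial-head (_ ∷ _) i = i

  JointStep-head : ∀ {𝒜 𝒜s a} (s sₗ sᵣ : JointState (𝒜 ∷ 𝒜s)) → JointStep a s sₗ sᵣ →
    RankedStep 𝒜 a (All.head s) (All.head sₗ) (All.head sᵣ) ×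
    JointStep a (All.tail s) (All.tail sₗ) (All.tail sᵣ)
  JointStep-head (_ ∷ _) (_ ∷ _) (_ ∷ _) st = st

  module _ (em : ExcludedMiddle 0ℓ) where

    Languages⇒joint : ∀ {t} 𝒜s → All (λ 𝒜 → Language 𝒜 t) 𝒜s → ∃ (IsJointRun {𝒜s} t)
    Languages⇒joint []       []       = (λ _ → []) , tt , λ _ → tt
    Languages⇒joint (𝒜 ∷ 𝒜s) (p ∷ ps) =
      let s  , root  , step  = Language⇒ranked 𝒜 em p
          ss , roots , steps = Languages⇒joint 𝒜s ps
      in (λ u → s u ∷ ss u) , (root , roots) , λ u → step u , steps u

    joint⇒Languages : ∀ {t} 𝒜s → ∃ (IsJointRun {𝒜s} t) → All (λ 𝒜 → Language 𝒜 t) 𝒜s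
    joint⇒Languages []       _                 = []
    joint⇒Languages (𝒜 ∷ 𝒜s) (s , root , step) =
      ranked⇒Language 𝒜 em (All.head ∘ s , proj₁ (JointInitial-head (s []) root) ,
        λ u → proj₁ (JointStep-head (s u) _ _ (step u))) ∷
      joint⇒Languages 𝒜s (All.tail ∘ s , proj₂ (JointInitial-head (s []) root) ,
        λ u → proj₂ (JointStep-head (s u) _ _ (step u)))

module _ (em : ExcludedMiddle 0ℓ) {A : Set} (A↪ℕ : A ↪ ℕ)
         (G : ℕ → Pred (Tree A) 0ℓ) where

  private
    automata : List (BüchiTreeAutomaton A) ↪ ℕ
    automata = List↪ℕ (BüchiTreeAutomaton↪ℕ A↪ℕ)

    state : (𝒜s : List (BüchiTreeAutomaton A)) → JointState 𝒜s ↪ ℕ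
    state = All↪ℕ λ 𝒜 → ×↪ℕ (Fin↪ℕ (BüchiTreeAutomaton.q₀ 𝒜)) (↪-id ℕ)

    address : (ℕ × Maybe Node) ↪ ℕ
    address = ×↪ℕ (↪-id ℕ) (Maybe↪ℕ Node↪ℕ)

    -- The value at (n , nothing) codes the automata witnessing that t lies in
    -- the open set G n, the value at (n , just u) their states at u.
    cell : (ℕ → ℕ) → ℕ → Maybe Node → ℕ
    cell w n x = w (RightInverse.to address (n , x))

    -- The automata must describe a basic open set inside `G n`, and the decoded states must form a
    -- joint run as far as `u` and its children show.
    LocalAt : ℕ → Node → List (BüchiTreeAutomaton A) → ℕ → ℕ → ℕ → A → Set
    LocalAt n u 𝒜s v vₗ vᵣ a =
      (∀ {y} → All (λ 𝒜 → Language 𝒜 y) 𝒜s → G n y) ×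
      (u ≡ [] → JointInitial (from v)) ×
      JointStep a (from v) (from vₗ) (from vᵣ)
      where open RightInverse (state 𝒜s)

    LocalAt-cong : ∀ {n u 𝒜s 𝒜s′ v v′ vₗ vₗ′ vᵣ vᵣ′ a a′} →
      𝒜s ≡ 𝒜s′ → v ≡ v′ → vₗ ≡ vₗ′ → vᵣ ≡ vᵣ′ → a ≡ a′ →
      LocalAt n u 𝒜s v vₗ vᵣ a → LocalAt n u 𝒜s′ v′ vₗ′ vᵣ′ a′
    LocalAt-cong refl refl refl refl refl p = p

  Witnesses : Tree A → (ℕ → ℕ) → Set
  Witnesses t w = ∀ n u → LocalAt n u (RightInverse.from automata (cell w n nothing))
    (cell w n (just u)) (cell w n (just (u ∷ʳ l))) (cell w n (just (u ∷ʳ r))) (t u)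

  Witnesses-closed : IsClosed Witnesses
  Witnesses-closed t w approximate n u =
    let c  = RightInverse.to address (n , nothing)
        i  = RightInverse.to address (n , just u)
        iₗ = RightInverse.to address (n , just (u ∷ʳ l))
        iᵣ = RightInverse.to address (n , just (u ∷ʳ r))
        -- The sum bounds the depth of `u` and the four positions of `w` that are read; `suc k`
        -- makes these bounds strict.
        k  = length u + (c + (i + (iₗ + iᵣ)))
        c≤k  = ℕ.m≤n⇒m≤o+n (length u) (ℕ.m≤m+n c (i + (iₗ + iᵣ)))
        i≤k  = ℕ.m≤n⇒m≤o+n (length u) (ℕ.m≤n⇒m≤o+n c (ℕ.m≤m+n i (iₗ + iᵣ)))
        iₗ≤k = ℕ.m≤n⇒m≤o+n (length u) (ℕ.m≤n⇒m≤o+n c (ℕ.m≤n⇒m≤o+n i (ℕ.m≤m+n iₗ iᵣ)))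
        iᵣ≤k = ℕ.m≤n⇒m≤o+n (length u) (ℕ.m≤n⇒m≤o+n c (ℕ.m≤n⇒m≤o+n i (ℕ.m≤n+m iᵣ iₗ)))
        t′ , w′ , t′≡t , w′≡w , wit = approximate (suc k)
    in LocalAt-cong (cong (RightInverse.from automata) (w′≡w c (s≤s c≤k)))
         (w′≡w i (s≤s i≤k)) (w′≡w iₗ (s≤s iₗ≤k)) (w′≡w iᵣ (s≤s iᵣ≤k))
         (t′≡t u (s≤s (ℕ.m≤m+n (length u) (c + (i + (iₗ + iᵣ)))))) (wit n u)

  Witnesses⇒∈ : ∀ {t} → ∃ (Witnesses t) → ∀ n → G n t
  Witnesses⇒∈ {t} (w , wit) n = proj₁ (wit n []) (joint⇒Languages em 𝒜s
    ( (λ u → RightInverse.from (state 𝒜s) (cell w n (just u)))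
    , proj₁ (proj₂ (wit n [])) refl
    , λ u → proj₂ (proj₂ (wit n u))))
    where
    𝒜s : List (BüchiTreeAutomaton A)
    𝒜s = RightInverse.from automata (cell w n nothing)

  -- The openness of `G n`, applied to the membership of `t`, yields a list of automata accepting
  -- `t`; `w` stores these lists and their ranked runs.
  ∈⇒Witnesses : (∀ n → Topology.Open (büchiTopology A) (G n)) →
    ∀ {t} → (∀ n → G n t) → ∃ (Witnesses t)
  ∈⇒Witnesses G-open {t} t∈G = w , λ n u →
    LocalAt-cong (sym (trans (cong (RightInverse.from automata) (cell-w n nothing))
                             (RightInverse.strictlyInverseʳ automata (𝒜s n))))
      (sym (cell-w n (just u))) (sym (cell-w n (just (u ∷ʳ l)))) (sym (cell-w n (just (u ∷ʳ r)))) refl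
      (proj₂ (proj₂ (G-open n (t∈G n)))
      , (λ { refl → subst JointInitial (sym (state-inverse n [])) (proj₁ (proj₂ (run n))) })
      , step n u)
    where
    𝒜s : ℕ → List (BüchiTreeAutomaton A)
    𝒜s n = proj₁ (G-open n (t∈G n))
    run : ∀ n → ∃ (IsJointRun {𝒜s = 𝒜s n} t)
    run n = Languages⇒joint em (𝒜s n) (proj₁ (proj₂ (G-open n (t∈G n))))
    value : ℕ × Maybe Node → ℕ
    value (n , nothing) = RightInverse.to automata (𝒜s n)
    value (n , just u)  = RightInverse.to (state (𝒜s n)) (proj₁ (run n) u)
    w : ℕ → ℕ
    w = value ∘ RightInverse.from address
    cell-w : ∀ n x → cell w n x ≡ value (n , x)
    cell-w n x = cong value (RightInverse.strictlyInverseʳ address (n , x))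
    state-inverse : ∀ n u →
      RightInverse.from (state (𝒜s n)) (value (n , just u)) ≡ proj₁ (run n) u
    state-inverse n u = RightInverse.strictlyInverseʳ (state (𝒜s n)) (proj₁ (run n) u)
    step : ∀ n u → let open RightInverse (state (𝒜s n)) in
      JointStep (t u) (from (value (n , just u))) (from (value (n , just (u ∷ʳ l))))
                      (from (value (n , just (u ∷ʳ r))))
    step n u rewrite state-inverse n u | state-inverse n (u ∷ʳ l) | state-inverse n (u ∷ʳ r) =
      proj₂ (proj₂ (run n)) u

-- The automaton for V

pattern wait = zero
pattern hit  = suc zero
pattern free = suc (suc zero)

-- The automaton guesses a branch: the nodes off that branch are in state free, the
-- nodes on it are in state hit or wait, according to whether the parent has label a.
module _ (em : ExcludedMiddle 0ℓ) {A : Set} {k : ℕ} (A↔Fin : A ↔ Fin k) (a : A) where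

  private
    follow : A → Fin 3
    follow x with em {x ≡ a}
    ... | yes _ = hit
    ... | no _  = wait

    follow-a : follow a ≡ hit
    follow-a with em {a ≡ a}
    ... | yes _  = refl
    ... | no a≢a = contradiction refl a≢a

    follow-hit : ∀ {x} → follow x ≡ hit → x ≡ a
    follow-hit {x} eq with em {x ≡ a}
    ... | yes x≡a = x≡a
    follow-hit {x} () | no _

    follow-≢free : ∀ x → follow x ≢ free
    follow-≢free x eq with em {x ≡ a}
    follow-≢free x () | yes _
    follow-≢free x () | no _

    data Transition : Fin 3 × A × Fin 3 × Fin 3 → Set where
      off : ∀ {x} → Transition (free , x , free , free)
      goˡ : ∀ {q x} → q ≢ free → Transition (q , x , follow x , free)
      goʳ : ∀ {q x} → q ≢ free → Transition (q , x , free , follow x)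

    quadruples : List (Fin 3 × A × Fin 3 × Fin 3)
    quadruples = cartesianProduct (allFin 3) (cartesianProduct (map (Inverse.from A↔Fin) (allFin k))
      (cartesianProduct (allFin 3) (allFin 3)))

    ∈-quadruples : ∀ τ → τ ∈ quadruples
    ∈-quadruples (p , x , qₗ , qᵣ) = ∈-cartesianProduct⁺ (∈-allFin p) (∈-cartesianProduct⁺
      (subst (_∈ map (Inverse.from A↔Fin) (allFin k)) (Inverse.strictlyInverseʳ A↔Fin x)
        (∈-map⁺ (Inverse.from A↔Fin) (∈-allFin (Inverse.to A↔Fin x))))
      (∈-cartesianProduct⁺ (∈-allFin qₗ) (∈-allFin qᵣ)))

  branchAutomaton : BüchiTreeAutomaton A
  branchAutomaton = record
    { states = 3
    ; q₀     = wait
    -- Off the guessed branch nothing is demanded, so `free` is final; on it `hit` has to recur.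
    ; Qf     = outside ∷ inside ∷ inside ∷ []
    ; Δ      = filter (λ τ → em {Transition τ}) quadruples
    }

  Language⇒HasBranch : ∀ {t} → Language branchAutomaton t → HasBranch a t
  Language⇒HasBranch {t} (ρ , (root , step) , acc) = β , hits
    where
    transition : ∀ u → Transition (ρ u , t u , ρ (u ∷ʳ l) , ρ (u ∷ʳ r))
    transition u = proj₂ (∈-filter⁻ (λ τ → em {Transition τ}) {xs = quadruples} (step u))

    Guessed : Pred Node 0ℓ
    Guessed u = ρ u ≢ free

    guessed-child : ∀ u → Guessed u → ∃[ d ] Guessed (u ∷ʳ d)
    guessed-child u q≢free with ρ u | t u | ρ (u ∷ʳ l) in eqₗ | ρ (u ∷ʳ r) in eqᵣ | transition u
    ... | _ | x | _ | _ | off   = contradiction refl q≢free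
    ... | _ | x | _ | _ | goˡ _ = l , λ eq → follow-≢free x (trans (sym eqₗ) eq)
    ... | _ | x | _ | _ | goʳ _ = r , λ eq → follow-≢free x (trans (sym eqᵣ) eq)

    guessed-root : Guessed []
    guessed-root eq with () ← trans (sym root) eq

    β : Branch
    β = path Guessed guessed-child ([] , guessed-root)

    guessed : ∀ n → Guessed (prefix β n)
    guessed = path-satisfies Guessed guessed-child ([] , guessed-root)

    follow-guess : ∀ u d → Guessed (u ∷ʳ d) → ρ (u ∷ʳ d) ≡ follow (t u)
    follow-guess u d g with ρ u | t u | ρ (u ∷ʳ l) in eqₗ | ρ (u ∷ʳ r) in eqᵣ | transition u
    follow-guess u l g | _ | x | _ | _ | off   = contradiction eqₗ g
    follow-guess u r g | _ | x | _ | _ | off   = contradiction eqᵣ g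
    follow-guess u l g | _ | x | _ | _ | goˡ _ = eqₗ
    follow-guess u r g | _ | x | _ | _ | goˡ _ = contradiction eqᵣ g
    follow-guess u l g | _ | x | _ | _ | goʳ _ = contradiction eqₗ g
    follow-guess u r g | _ | x | _ | _ | goʳ _ = eqᵣ

    hits : InfinitelyOften (λ n → t (prefix β n) ≡ a)
    hits n with acc β
    ... | wait , () , _
    ... | free , _ , often = let m , _ , eq = often 0 in contradiction eq (guessed m)
    -- `hit` reports the label of the parent, so a visit at depth `suc m` gives an `a` at depth `m`.
    ... | hit , _ , often with suc m , s≤s n≤m , eq ← often (suc n) = m , n≤m ,
      follow-hit (trans (sym (follow-guess (prefix β m) (β m) (guessed (suc m)))) eq)

  HasBranch⇒Language : ∀ {t} → HasBranch a t → Language branchAutomaton t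
  HasBranch⇒Language {t} (β , hits) =
    ρ , (ρ-on 0 , λ u → ∈-filter⁺ _ (∈-quadruples _) (step u)) , accepting
    where
    OnBranch : Pred Node 0ℓ
    OnBranch u = u ≡ prefix β (length u)

    prefix-onBranch : ∀ n → OnBranch (prefix β n)
    prefix-onBranch n = cong (prefix β) (sym (length-prefix β n))

    onBranch-∷ʳ : ∀ u d → OnBranch (u ∷ʳ d) → OnBranch u × d ≡ β (length u)
    onBranch-∷ʳ u d eq = ∷ʳ-injective u _ (trans eq (cong (prefix β) (length-∷ʳ u d)))

    entry : ℕ → Fin 3
    entry zero    = wait
    entry (suc n) = follow (t (prefix β n))

    entry-≢free : ∀ n → entry n ≢ free
    entry-≢free zero    ()
    entry-≢free (suc n) = follow-≢free (t (prefix β n))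

    ρ : Node → Fin 3
    ρ u with em {OnBranch u}
    ... | yes _ = entry (length u)
    ... | no _  = free

    ρ-off : ∀ {u} → ¬ OnBranch u → ρ u ≡ free
    ρ-off {u} ¬on with em {OnBranch u}
    ... | yes on = contradiction on ¬on
    ... | no _   = refl

    ρ-onBranch : ∀ {u} → OnBranch u → ρ u ≡ entry (length u)
    ρ-onBranch {u} on with em {OnBranch u}
    ... | yes _  = refl
    ... | no ¬on = contradiction on ¬on

    ρ-on : ∀ n → ρ (prefix β n) ≡ entry n
    ρ-on n = trans (ρ-onBranch (prefix-onBranch n)) (cong entry (length-prefix β n))

    ρ-child : ∀ u d → OnBranch u → β (length u) ≡ d → ρ (u ∷ʳ d) ≡ follow (t u)
    ρ-child u _ on refl = trans
      (ρ-onBranch (trans (cong (_∷ʳ β (length u)) on) (sym (cong (prefix β) (length-∷ʳ u _)))))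
      (trans (cong entry (length-∷ʳ u _)) (cong (follow ∘ t) (sym on)))

    ρ-sibling : ∀ u d → β (length u) ≢ d → ρ (u ∷ʳ d) ≡ free
    ρ-sibling u d ≢d = ρ-off (≢d ∘ sym ∘ proj₂ ∘ onBranch-∷ʳ u d)

    l≢r : l ≢ r
    l≢r ()

    step : ∀ u → Transition (ρ u , t u , ρ (u ∷ʳ l) , ρ (u ∷ʳ r))
    step u = cases em (β (length u)) refl
      where
      cases : Dec (OnBranch u) → ∀ d → β (length u) ≡ d →
        Transition (ρ u , t u , ρ (u ∷ʳ l) , ρ (u ∷ʳ r))
      cases (no ¬on) _ _
        rewrite ρ-off ¬on
              | ρ-off (¬on ∘ proj₁ ∘ onBranch-∷ʳ u l)
              | ρ-off (¬on ∘ proj₁ ∘ onBranch-∷ʳ u r) = off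
      cases (yes on) l eq
        rewrite ρ-onBranch on | ρ-child u l on eq | ρ-sibling u r (λ eq′ → l≢r (trans (sym eq) eq′)) =
        goˡ (entry-≢free (length u))
      cases (yes on) r eq
        rewrite ρ-onBranch on | ρ-child u r on eq | ρ-sibling u l (λ eq′ → l≢r (trans (sym eq′) eq)) =
        goʳ (entry-≢free (length u))

    off-∷ʳ : ∀ {γ m n} → m ≤′ n → ¬ OnBranch (prefix γ m) → ¬ OnBranch (prefix γ n)
    off-∷ʳ     ≤′-refl           ¬on = ¬on
    off-∷ʳ {γ} (≤′-step {n} m≤n) ¬on = off-∷ʳ {γ} m≤n ¬on ∘ proj₁ ∘ onBranch-∷ʳ (prefix γ n) (γ n)

    -- A branch that leaves `β` stays in `free`; one that never does passes every `a` on `β` and is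
    -- in `hit` one step later.
    accepting : IsAccepting branchAutomaton ρ
    accepting γ with em {∃[ n ] ¬ OnBranch (prefix γ n)}
    ... | yes (n , ¬on) = free , there (there here) , λ m → m ⊔ n , ℕ.m≤m⊔n m n ,
      ρ-off (off-∷ʳ {γ} (ℕ.≤⇒≤′ (ℕ.m≤n⊔m m n)) ¬on)
    ... | no never-off = hit , there here , λ n →
      let m , n≤m , t≡a = hits n
          on = ¬¬-elim em {OnBranch (prefix γ (suc m))} λ ¬on → never-off (suc m , ¬on)
      in suc m , ℕ.m≤n⇒m≤1+n n≤m ,
         trans (ρ-onBranch on) (trans (cong entry (length-prefix γ (suc m)))
           (trans (cong follow t≡a) follow-a))

-- Closed sets in metric spaces

½*-pos : ∀ {δ} → 0ℚ ℚ.< δ → 0ℚ ℚ.< ½ ℚ.* δ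
½*-pos {δ} 0<δ = subst (ℚ._< ½ ℚ.* δ) (ℚ.*-zeroʳ ½) (ℚ.*-monoʳ-<-pos ½ 0<δ)

½+½ : ∀ δ → ½ ℚ.* δ ℚ.+ ½ ℚ.* δ ≡ δ
½+½ δ = trans (sym (ℚ.*-distribʳ-+ δ ½ ½)) (ℚ.*-identityˡ δ)

p≤p+q : ∀ p {q} → 0ℚ ℚ.< q → p ℚ.≤ p ℚ.+ q
p≤p+q p {q} 0<q = subst (ℚ._≤ p ℚ.+ q) (ℚ.+-identityʳ p) (ℚ.+-monoʳ-≤ p (ℚ.<⇒≤ 0<q))

-- `mkℚ` takes the denominator minus one, so this is 1/(n+1).
1/1+_ : ℕ → ℚ
1/1+ n = mkℚ (+ 1) n (1-coprimeTo (suc n))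

1/1+-pos : ∀ n → 0ℚ ℚ.< 1/1+ n
1/1+-pos n = *<* (ℤ.+<+ (ℕ.s≤s ℕ.z≤n))

-- A positive rational has numerator at least 1, so the reciprocal of its own denominator will do.
1/1+-≤ : ∀ {δ} → 0ℚ ℚ.< δ → ∃[ n ] 1/1+ n ℚ.≤ δ
1/1+-≤ {mkℚ (+ suc p) n _}      _       = n ,
  *≤* (ℤ.*-monoʳ-≤-nonNeg (+ suc n) (ℤ.+≤+ (ℕ.s≤s (ℕ.z≤n {p}))))
1/1+-≤ {mkℚ (+ zero) _ _}       (*<* (ℤ.+<+ ()))
1/1+-≤ {mkℚ ℤ.-[1+ _ ] _ _}     (*<* ())

constᴿ : ℚ → ℝ
constᴿ q = record
  { seq    = λ _ → q
  ; cauchy = λ ε 0<ε → 0 , λ _ _ _ _ →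
      subst (λ p → ∣ p ∣ ℚ.≤ ε) (sym (ℚ.+-inverseʳ q)) (ℚ.<⇒≤ 0<ε)
  }

constᴿ-pos : ∀ {q} → 0ℚ ℚ.< q → 0ᴿ <ᴿ constᴿ q
constᴿ-pos {q} 0<q = q , 0<q , 0 , λ _ _ → ℚ.≤-reflexive (ℚ.+-identityˡ q)

≤ᴿ-<ᴿ-trans : ∀ x y z → x ≤ᴿ y → y <ᴿ z → x <ᴿ z
≤ᴿ-<ᴿ-trans x y z x≤y (δ , 0<δ , N , y<z)
  with M , x≤ ← x≤y (½ ℚ.* δ) (½*-pos 0<δ)
  = ½ ℚ.* δ , ½*-pos 0<δ , M ⊔ N , λ n le → begin
    seq x n ℚ.+ ½ ℚ.* δ                  ≤⟨ ℚ.+-monoˡ-≤ (½ ℚ.* δ) (x≤ n (ℕ.m⊔n≤o⇒m≤o M N le)) ⟩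
    seq y n ℚ.+ ½ ℚ.* δ ℚ.+ ½ ℚ.* δ      ≡⟨ ℚ.+-assoc (seq y n) _ _ ⟩
    seq y n ℚ.+ (½ ℚ.* δ ℚ.+ ½ ℚ.* δ)    ≡⟨ cong (seq y n ℚ.+_) (½+½ δ) ⟩
    seq y n ℚ.+ δ                        ≤⟨ y<z n (ℕ.m⊔n≤o⇒n≤o M N le) ⟩
    seq z n                              ∎
  where open ℚ.≤-Reasoning

<ᴿ-trans : ∀ x y z → x <ᴿ y → y <ᴿ z → x <ᴿ z
<ᴿ-trans x y z (δ , 0<δ , M , x<y) (δ′ , 0<δ′ , N , y<z) = δ , 0<δ , M ⊔ N , λ n le →
  ℚ.≤-trans (x<y n (ℕ.m⊔n≤o⇒m≤o M N le))
    (ℚ.≤-trans (p≤p+q (seq y n) 0<δ′) (y<z n (ℕ.m⊔n≤o⇒n≤o M N le)))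

1/1+-<ᴿ : ∀ ε → 0ᴿ <ᴿ ε → ∃[ n ] constᴿ (1/1+ n) <ᴿ ε
1/1+-<ᴿ ε (δ , 0<δ , N , 0<ε) with n , small ← 1/1+-≤ (½*-pos 0<δ)
  = n , ½ ℚ.* δ , ½*-pos 0<δ , N , λ m le → begin
    1/1+ n ℚ.+ ½ ℚ.* δ       ≤⟨ ℚ.+-monoˡ-≤ (½ ℚ.* δ) small ⟩
    ½ ℚ.* δ ℚ.+ ½ ℚ.* δ      ≡⟨ ½+½ δ ⟩
    δ                        ≡⟨ ℚ.+-identityˡ δ ⟨
    0ℚ ℚ.+ δ                 ≤⟨ 0<ε m le ⟩
    seq ε m                  ∎
  where open ℚ.≤-Reasoning

-- The gap witnessing the strict inequality is the room left for `y`; in `Near-open` it becomes the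
-- radius of a ball.
<ᴿ-slack : ∀ x q → x <ᴿ constᴿ q →
  ∃[ δ ] (0ℚ ℚ.< δ × (∀ y → y <ᴿ constᴿ δ → x +ᴿ y <ᴿ constᴿ q))
<ᴿ-slack x q (δ , 0<δ , M , x<q) = δ , 0<δ , λ y (δ′ , 0<δ′ , N , y<δ) →
  δ′ , 0<δ′ , M ⊔ N , λ n le → begin
    seq x n ℚ.+ seq y n ℚ.+ δ′       ≡⟨ ℚ.+-assoc (seq x n) _ _ ⟩
    seq x n ℚ.+ (seq y n ℚ.+ δ′)     ≤⟨ ℚ.+-monoʳ-≤ (seq x n) (y<δ n (ℕ.m⊔n≤o⇒n≤o M N le)) ⟩
    seq x n ℚ.+ δ                    ≤⟨ x<q n (ℕ.m⊔n≤o⇒m≤o M N le) ⟩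
    q                                ∎
  where open ℚ.≤-Reasoning

module _ (X : Setoid 0ℓ 0ℓ) {d : Setoid.Carrier X → Setoid.Carrier X → ℝ}
         (metric : IsMetric {X} d) where
  open Setoid X using (Carrier)
  open IsGeneralMetric metric using (≈⇒0; triangle; module EqC) renaming (sym to d-sym)

  -- The union of the balls of radius 1/(n+1) around the points of `C`; for closed `C` these sets
  -- decrease to `C`.
  Near : Pred Carrier 0ℓ → ℕ → Pred Carrier 0ℓ
  Near C n y = ∃[ z ] (C z × d z y <ᴿ constᴿ (1/1+ n))

  Near-open : ∀ C n → MetricOpen {X} d (Near C n)
  Near-open C n {x} (z , z∈C , dzx<) with δ , 0<δ , slack ← <ᴿ-slack (d z x) (1/1+ n) dzx< =
    constᴿ δ , constᴿ-pos 0<δ , λ {y} dxy< → z , z∈C ,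
      ≤ᴿ-<ᴿ-trans (d z y) (d z x +ᴿ d x y) (constᴿ (1/1+ n)) (triangle z x y) (slack (d x y) dxy<)

  ⊆Near : ∀ C n {y} → C y → Near C n y
  ⊆Near C n {y} y∈C = y , y∈C ,
    ≤ᴿ-<ᴿ-trans (d y y) 0ᴿ (constᴿ (1/1+ n)) (proj₁ (≈⇒0 EqC.refl)) (constᴿ-pos (1/1+-pos n))

  -- Once 1/(n+1) is below the radius of a ball around `x` inside `V`, no point outside `V` is that
  -- close to `x`.
  open-disjoint-from-Near : ∀ {V} → MetricOpen {X} d V →
    ∀ {x} → V x → ¬ (∀ n → Near (¬_ ∘ V) n x)
  open-disjoint-from-Near V-open {x} x∈V near
    with ε , 0<ε , ball⊆V ← V-open x∈V
    with n , small ← 1/1+-<ᴿ ε 0<ε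
    with z , z∉V , dzx< ← near n
    = z∉V (ball⊆V (≤ᴿ-<ᴿ-trans (d x z) (d z x) ε (proj₁ (d-sym x z))
        (<ᴿ-trans (d z x) (constᴿ (1/1+ n)) ε dzx< small)))

-- Non-metrizability of the Büchi topology

Language-open : ∀ {A : Set} (𝒜 : BüchiTreeAutomaton A) →
  Topology.Open (büchiTopology A) (Language 𝒜)
Language-open 𝒜 t∈L = 𝒜 ∷ [] , t∈L ∷ [] , All.head

büchiTopology-not-metrizable : ExcludedMiddle 0ℓ →
  (A : Set) (n : ℕ) → A ↔ Fin n → 2 ≤ n → ¬ Metrizable (büchiTopology A)
büchiTopology-not-metrizable em A (suc (suc k)) A↔Fin (s≤s (s≤s z≤n)) (d , metric , induces) =
  -- Not being in `V`, the diagonal tree lies in every `G n`, so it is related by `R` to some `w`;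
  -- this gives it a branch and puts it in `V`.
  ∉V (HasBranch⇒Language em A↔Fin a
    (diagonal-HasBranch em a≢b R (∈⇒Witnesses em A↪ℕ G G-open λ n →
      ⊆Near (treeSetoid A) metric (¬_ ∘ V) n ∉V)))
  where
  a b : A
  a = Inverse.from A↔Fin zero
  b = Inverse.from A↔Fin (suc zero)

  a≢b : a ≢ b
  a≢b eq with () ← trans (sym (Inverse.strictlyInverseˡ A↔Fin zero))
                     (trans (cong (Inverse.to A↔Fin) eq) (Inverse.strictlyInverseˡ A↔Fin (suc zero)))

  A↪ℕ : A ↪ ℕ
  A↪ℕ = Fin↪ℕ zero ↪-∘ ↔⇒↪ A↔Fin

  V : Pred (Tree A) 0ℓ
  V = Language (branchAutomaton em A↔Fin a)

  G : ℕ → Pred (Tree A) 0ℓ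
  G = Near (treeSetoid A) metric (¬_ ∘ V)

  G-open : ∀ n → Topology.Open (büchiTopology A) (G n)
  G-open n = Equivalence.from (induces (G n)) (Near-open (treeSetoid A) metric (¬_ ∘ V) n)

  R : Tree A → (ℕ → ℕ) → Set
  R = Witnesses em A↪ℕ G

  -- If the tree were in `V`, its branch would yield a `w` related to it by `R`, so it would lie in
  -- every `G n`, as no point of the open set `V` does.
  ∉V : ¬ V (diagonal em a≢b R)
  ∉V ∈V = open-disjoint-from-Near (treeSetoid A) metric
    (Equivalence.to (induces V) (Language-open _)) ∈V
    (Witnesses⇒∈ em A↪ℕ G (diagonal-HasBranch⁻¹ em a≢b R (Witnesses-closed em A↪ℕ G)
      (Language⇒HasBranch em A↔Fin a ∈V)))

theorem4p4 : ExcludedMiddle 0ℓ →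
    (A : Set) (n : ℕ) → A ↔ Fin n → 2 ≤ n →
    (¬ Metrizable (büchiTopology A)) × (¬ Polish (büchiTopology A))
theorem4p4 em A n A↔Fin 2≤n = ¬metrizable ,
  λ (_ , d , metric , _ , induces) → ¬metrizable (d , metric , induces)
  where
  ¬metrizable : ¬ Metrizable (büchiTopology A)
  ¬metrizable = büchiTopology-not-metrizable em A n A↔Fin 2≤n
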